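{- Let $L$ be a finite lattice and $P\subseteq L$. If the dependency digraph of $P$ contains a directed cycle, then $P$ is not order-induced submodular in $L$, i.e. there are no submodular function $f\colon L\to\mathbb R_{\ge0}$ and real number $k$ such that $P=\{a\in L\mid f(a)<k\}$.
   Context: A function $f\colon L\to\mathbb R_{\ge0}$ on a lattice $L$ is submodular if $f(a\vee b)+f(a\wedge b)\le f(a)+f(b)$ for all $a,b\in L$. For a subset $P$ of a lattice $L$, the dependency digraph of $P$ is the directed graph with vertex set $L$ in which $(a,b)$ is an edge if and only if one of the following holds: (i) $a\in L\setminus P$ and $b\in P$; (ii) $a,b\in P$ and there is some $c\in P$ such that either $b=a\vee c$ and $a\wedge c\notin P$, or $b=a\wedge c$ and $a\vee c\notin P$; (iii) $a,b\notin P$ and there is some $c\in P$ such that either $b=a\vee c$ and $a\wedge c\notin P$, or $b=a\wedge c$ and $a\vee c\notin P$. -}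

module Defs where

open import Data.Fin using (Fin)
open import Data.List using (List; _∷_; _∷ʳ_)
import Data.List.Relation.Unary.Linked as Linked
import Data.List.Relation.Unary.Unique.Setoid as UniqueSetoid
open import Data.Nat as ℕ using (ℕ)
import Data.Nat.Properties as ℕ
open import Data.Product using (∃-syntax; _×_; _,_)
open import Data.Rational using (ℚ; 0ℚ; ½; _+_; _*_; _-_; ∣_∣; _≤_; _<_; positive)
import Data.Rational.Properties as ℚ
open import Data.Rational.Solver using (module +-*-Solver)
open import Data.Sum using (_⊎_)
open import Function.Bundles using (Inverse)
open import Level using (Level; _⊔_)
open import Relation.Binary.Bundles using (Setoid)
open import Relation.Binary.Core using (Rel)
open import Relation.Binary.Lattice using (Lattice)
open import Relation.Binary.PropositionalEquality as ≡ using (_≡_; refl; cong)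
open import Relation.Nullary using (¬_)
open import Relation.Unary using (Pred; _≐_)

private
  variable
    o ℓ ℓ₁ ℓ₂ p r : Level

-- A real number is a Cauchy sequence of rationals.  Distinct sequences may
-- represent the same real: equality is _≃ℝ_, not _≡_.

record ℝ : Set where
  constructor mkℝ
  field
    seq    : ℕ → ℚ
    cauchy : ∀ ε → 0ℚ < ε →
             ∃[ N ] (∀ m n → N ℕ.≤ m → N ℕ.≤ n → ∣ seq m - seq n ∣ < ε)

open ℝ public

infix  4 _<ℝ_ _≤ℝ_ _≃ℝ_
infixl 6 _+ℝ_

-- x is less than y when, from some index on, y exceeds x by at least a fixed
-- positive rational; mere termwise inequality would not respect _≃ℝ_.

_<ℝ_ : Rel ℝ _
x <ℝ y = ∃[ ε ] (0ℚ < ε × ∃[ N ] (∀ n → N ℕ.≤ n → seq x n + ε ≤ seq y n))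

_≤ℝ_ : Rel ℝ _
x ≤ℝ y = ∀ ε → 0ℚ < ε → ∃[ N ] (∀ n → N ℕ.≤ n → seq x n ≤ seq y n + ε)

_≃ℝ_ : Rel ℝ _
x ≃ℝ y = x ≤ℝ y × y ≤ℝ x

0ℝ : ℝ
0ℝ = mkℝ (λ _ → 0ℚ) (λ _ 0<ε → 0 , λ _ _ _ _ → 0<ε)

private
  0<½* : ∀ {ε} → 0ℚ < ε → 0ℚ < ½ * ε
  0<½* {ε} 0<ε = ℚ.positive⁻¹ (½ * ε) {{ℚ.pos*pos⇒pos ½ ε {{positive 0<ε}}}}

  ½+½ : ∀ ε → ½ * ε + ½ * ε ≡ ε
  ½+½ ε = ≡.trans (≡.sym (ℚ.*-distribʳ-+ ε ½ ½)) (ℚ.*-identityˡ ε)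

  interchange : ∀ a b a′ b′ → (a + b) - (a′ + b′) ≡ (a - a′) + (b - b′)
  interchange = solve 4
    (λ a b a′ b′ → (a :+ b) :- (a′ :+ b′) := (a :- a′) :+ (b :- b′)) refl
    where open +-*-Solver

_+ℝ_ : ℝ → ℝ → ℝ
seq    (x +ℝ y) n = seq x n + seq y n
cauchy (x +ℝ y) ε 0<ε
  with cauchy x (½ * ε) (0<½* 0<ε) | cauchy y (½ * ε) (0<½* 0<ε)
... | M , x-close | N , y-close = M ℕ.⊔ N , close
  where
  open ℚ.≤-Reasoning
  close : ∀ m n → M ℕ.⊔ N ℕ.≤ m → M ℕ.⊔ N ℕ.≤ n →
          ∣ (seq x m + seq y m) - (seq x n + seq y n) ∣ < ε
  close m n ≤m ≤n = begin-strict
    ∣ (seq x m + seq y m) - (seq x n + seq y n) ∣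
      ≡⟨ cong ∣_∣ (interchange (seq x m) (seq y m) (seq x n) (seq y n)) ⟩
    ∣ (seq x m - seq x n) + (seq y m - seq y n) ∣
      ≤⟨ ℚ.∣p+q∣≤∣p∣+∣q∣ (seq x m - seq x n) (seq y m - seq y n) ⟩
    ∣ seq x m - seq x n ∣ + ∣ seq y m - seq y n ∣
      <⟨ ℚ.+-mono-< (x-close m n (ℕ.m⊔n≤o⇒m≤o M N ≤m) (ℕ.m⊔n≤o⇒m≤o M N ≤n))
                    (y-close m n (ℕ.m⊔n≤o⇒n≤o M N ≤m) (ℕ.m⊔n≤o⇒n≤o M N ≤n)) ⟩
    ½ * ε + ½ * ε
      ≡⟨ ½+½ ε ⟩
    ε ∎

Finite : Setoid o ℓ → Set (o ⊔ ℓ)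
Finite S = ∃[ n ] Inverse (≡.setoid (Fin n)) S

-- A directed cycle v → v₁ → … → vₙ → v on pairwise distinct vertices
-- v, v₁, …, vₙ (n ≥ 0, so a loop counts as a cycle of length one).

record DirectedCycle (V : Setoid o ℓ) (E : Rel (Setoid.Carrier V) r)
       : Set (o ⊔ ℓ ⊔ r) where
  open UniqueSetoid V using (Unique)
  field
    start    : Setoid.Carrier V
    rest     : List (Setoid.Carrier V)
    distinct : Unique (start ∷ rest)
    edges    : Linked.Linked E (start ∷ (rest ∷ʳ start))

module _ (L : Lattice o ℓ₁ ℓ₂) where
  open Lattice L using (Carrier; _≈_; _∨_; _∧_)

  DependencyDigraph : Pred Carrier p → Rel Carrier (o ⊔ ℓ₁ ⊔ p)
  DependencyDigraph P a b =
      (¬ P a × P b)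
    ⊎ (P a × P b × Via)
    ⊎ (¬ P a × ¬ P b × Via)
    where
    Via = ∃[ c ] (P c × ((b ≈ a ∨ c × ¬ P (a ∧ c)) ⊎ (b ≈ a ∧ c × ¬ P (a ∨ c))))

  Submodular : (Carrier → ℝ) → Set o
  Submodular f = ∀ a b → f (a ∨ b) +ℝ f (a ∧ b) ≤ℝ f a +ℝ f b

  record OrderInducedSubmodular (P : Pred Carrier p) : Set (o ⊔ ℓ₁ ⊔ p) where
    field
      f           : Carrier → ℝ
      f-cong      : ∀ {a b} → a ≈ b → f a ≃ℝ f b
      nonNegative : ∀ a → 0ℝ ≤ℝ f a
      submodular  : Submodular f
      k           : ℝ
      sublevel    : P ≐ (λ a → f a <ℝ k)

{-# OPTIONS --safe #-}
module Submission where

open import Defs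
open import Relation.Binary.Definitions using (_Respects_; Transitive; Irreflexive)
open import Relation.Binary.Lattice using (Lattice)
open import Relation.Nullary using (¬_; yes; no)
open import Relation.Unary using (Pred)

open import Data.Empty using (⊥-elim)
open import Data.List using (List; []; _∷_; _∷ʳ_)
open import Data.List.Relation.Unary.Linked as Linked using (Linked; [-]; _∷_)
import Data.Nat as ℕ
import Data.Nat.Properties as ℕ
open import Data.Product using (∃-syntax; _×_; _,_; proj₁; proj₂)
open import Data.Rational using (ℚ; 0ℚ; ½; _+_; _*_; _-_; -_; ∣_∣; _≤_; _<_; _≤?_; positive)
import Data.Rational.Properties as ℚ
open import Data.Rational.Solver using (module +-*-Solver)
open import Data.Sum using (inj₁; inj₂)
open import Relation.Binary.Core using (Rel)
open import Relation.Binary.PropositionalEquality using (_≡_; refl; sym; trans; subst; subst₂)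

-- An edge a → b of the dependency digraph forces f b < f a.  This is clear for
-- edges entering P from outside.  For the others submodularity gives
-- f b + f d ≤ f a + f c with f c < k ≤ f d, where c ∈ P, d ∉ P and
-- {b , d} = {a ∨ c , a ∧ c}.  Hence f strictly decreases along a directed
-- cycle, which is absurd.

open +-*-Solver using (solve; _:=_; _:+_; _:-_)

p+q-q≡p : ∀ p q → (p + q) - q ≡ p
p+q-q≡p = solve 2 (λ p q → (p :+ q) :- q := p) refl

+-cancelʳ-≤ : ∀ r {p q} → p + r ≤ q + r → p ≤ q
+-cancelʳ-≤ r {p} {q} p+r≤q+r =
  subst₂ _≤_ (p+q-q≡p p r) (p+q-q≡p q r) (ℚ.+-monoˡ-≤ (- r) p+r≤q+r)

-- The equation lets a match on `refl` rewrite the given bound as `η + η`, so that the two halves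
-- can be spent separately.
halve : ∀ {ε} → 0ℚ < ε → ∃[ η ] (0ℚ < η × η + η ≡ ε)
halve {ε} 0<ε =
  ½ * ε ,
  ℚ.positive⁻¹ (½ * ε) {{ℚ.pos*pos⇒pos ½ ε {{positive 0<ε}}}} ,
  trans (sym (ℚ.*-distribʳ-+ ε ½ ½)) (ℚ.*-identityˡ ε)

p≤∣p∣ : ∀ p → p ≤ ∣ p ∣
p≤∣p∣ p with ℚ.≤-total 0ℚ p
... | inj₁ 0≤p = ℚ.≤-reflexive (sym (ℚ.0≤p⇒∣p∣≡p 0≤p))
... | inj₂ p≤0 = ℚ.≤-trans p≤0 (ℚ.0≤∣p∣ p)

∣p-q∣<r⇒p≤q+r : ∀ p q {r} → ∣ p - q ∣ < r → p ≤ q + r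
∣p-q∣<r⇒p≤q+r p q {r} ∣p-q∣<r = begin
  p            ≡⟨ solve 2 (λ p q → p := q :+ (p :- q)) refl p q ⟩
  q + (p - q)  ≤⟨ ℚ.+-monoʳ-≤ q (ℚ.≤-trans (p≤∣p∣ (p - q)) (ℚ.<⇒≤ ∣p-q∣<r)) ⟩
  q + r        ∎
  where open ℚ.≤-Reasoning

<ℝ-irrefl : Irreflexive _≡_ _<ℝ_
<ℝ-irrefl {x} refl (ε , 0<ε , N , x+ε≤x) = ℚ.<-irrefl refl (ℚ.<-≤-trans 0<ε (+-cancelʳ-≤ (seq x N) (begin
  ε + seq x N   ≡⟨ ℚ.+-comm ε (seq x N) ⟩
  seq x N + ε   ≤⟨ x+ε≤x N ℕ.≤-refl ⟩
  seq x N       ≡⟨ sym (ℚ.+-identityˡ (seq x N)) ⟩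
  0ℚ + seq x N  ∎)))
  where open ℚ.≤-Reasoning

-- Half of the gap `δ` pays for the slack in `y ≤ℝ z`; the other half survives as the gap between
-- `x` and `z`.
<ℝ-≤ℝ-trans : ∀ {x y z} → x <ℝ y → y ≤ℝ z → x <ℝ z
<ℝ-≤ℝ-trans {x} {y} {z} (δ , 0<δ , M , x+δ≤y) y≤z with halve 0<δ
... | η , 0<η , refl with y≤z η 0<η
... | N , y≤z+η = η , 0<η , M ℕ.⊔ N , λ n ≤n → +-cancelʳ-≤ η (begin
  seq x n + η + η    ≡⟨ ℚ.+-assoc (seq x n) η η ⟩
  seq x n + (η + η)  ≤⟨ x+δ≤y n (ℕ.m⊔n≤o⇒m≤o M N ≤n) ⟩
  seq y n            ≤⟨ y≤z+η n (ℕ.m⊔n≤o⇒n≤o M N ≤n) ⟩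
  seq z n + η        ∎)
  where open ℚ.≤-Reasoning

≤ℝ-<ℝ-trans : ∀ {x y z} → x ≤ℝ y → y <ℝ z → x <ℝ z
≤ℝ-<ℝ-trans {x} {y} {z} x≤y (δ , 0<δ , M , y+δ≤z) with halve 0<δ
... | η , 0<η , refl with x≤y η 0<η
... | N , x≤y+η = η , 0<η , M ℕ.⊔ N , λ n ≤n → begin
  seq x n + η        ≤⟨ ℚ.+-monoˡ-≤ η (x≤y+η n (ℕ.m⊔n≤o⇒n≤o M N ≤n)) ⟩
  seq y n + η + η    ≡⟨ ℚ.+-assoc (seq y n) η η ⟩
  seq y n + (η + η)  ≤⟨ y+δ≤z n (ℕ.m⊔n≤o⇒m≤o M N ≤n) ⟩
  seq z n            ∎
  where open ℚ.≤-Reasoning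

<ℝ⇒≤ℝ : ∀ {x y} → x <ℝ y → x ≤ℝ y
<ℝ⇒≤ℝ {x} {y} (δ , 0<δ , N , x+δ≤y) ε 0<ε = N , λ n N≤n → begin
  seq x n       ≡⟨ sym (ℚ.+-identityʳ (seq x n)) ⟩
  seq x n + 0ℚ  ≤⟨ ℚ.+-monoʳ-≤ (seq x n) (ℚ.<⇒≤ 0<δ) ⟩
  seq x n + δ   ≤⟨ x+δ≤y n N≤n ⟩
  seq y n       ≡⟨ sym (ℚ.+-identityʳ (seq y n)) ⟩
  seq y n + 0ℚ  ≤⟨ ℚ.+-monoʳ-≤ (seq y n) (ℚ.<⇒≤ 0<ε) ⟩
  seq y n + ε   ∎
  where open ℚ.≤-Reasoning

<ℝ-trans : Transitive _<ℝ_
<ℝ-trans {x} {y} {z} x<y y<z = <ℝ-≤ℝ-trans {x} {y} {z} x<y (<ℝ⇒≤ℝ {y} {z} y<z)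

-- Within the Cauchy modulus for θ = ε/4, a single index n with x n + ε < y n
-- already yields x <ℝ y with gap ε/2; so no such n exists.
≮ℝ⇒≥ℝ : ∀ {x y} → ¬ (x <ℝ y) → y ≤ℝ x
≮ℝ⇒≥ℝ {x} {y} x≮y ε 0<ε with halve 0<ε
... | η , 0<η , refl with halve 0<η
... | θ , 0<θ , refl with cauchy x θ 0<θ | cauchy y θ 0<θ
... | M , x-close | N , y-close = K , y≤x+ε
  where
  open ℚ.≤-Reasoning
  K = M ℕ.⊔ N

  gap : ∀ n → K ℕ.≤ n → seq x n + ((θ + θ) + (θ + θ)) < seq y n → x <ℝ y
  gap n K≤n xₙ+ε<yₙ = θ + θ , 0<η , K , λ m K≤m → +-cancelʳ-≤ θ (begin
    seq x m + (θ + θ) + θ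
      ≤⟨ ℚ.+-monoˡ-≤ θ (ℚ.+-monoˡ-≤ (θ + θ) (∣p-q∣<r⇒p≤q+r (seq x m) (seq x n)
           (x-close m n (ℕ.m⊔n≤o⇒m≤o M N K≤m) (ℕ.m⊔n≤o⇒m≤o M N K≤n)))) ⟩
    seq x n + θ + (θ + θ) + θ
      ≡⟨ solve 2 (λ p t → p :+ t :+ (t :+ t) :+ t := p :+ ((t :+ t) :+ (t :+ t)))
           refl (seq x n) θ ⟩
    seq x n + ((θ + θ) + (θ + θ))
      ≤⟨ ℚ.<⇒≤ xₙ+ε<yₙ ⟩
    seq y n
      ≤⟨ ∣p-q∣<r⇒p≤q+r (seq y n) (seq y m)
           (y-close n m (ℕ.m⊔n≤o⇒n≤o M N K≤n) (ℕ.m⊔n≤o⇒n≤o M N K≤m)) ⟩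
    seq y m + θ ∎)

  y≤x+ε : ∀ n → K ℕ.≤ n → seq y n ≤ seq x n + ((θ + θ) + (θ + θ))
  -- The order on ℚ is decidable, so at each index either the bound holds or `gap` contradicts
  -- `x≮y`; no case split on reals is required.
  y≤x+ε n K≤n with seq y n ≤? seq x n + ((θ + θ) + (θ + θ))
  ... | yes yₙ≤xₙ+ε = yₙ≤xₙ+ε
  ... | no  yₙ≰xₙ+ε = ⊥-elim (x≮y (gap n K≤n (ℚ.≰⇒> yₙ≰xₙ+ε)))

-- Adding the two inequalities cancels `x` and `z`. Half of the gap in `z <ℝ x` absorbs the slack of
-- the inequality between sums, so strictness is kept.
+ℝ-exchangeʳ : ∀ {w x y z} → w +ℝ x ≤ℝ y +ℝ z → z <ℝ x → w <ℝ y
+ℝ-exchangeʳ {w} {x} {y} {z} w+x≤y+z (δ , 0<δ , M , z+δ≤x) with halve 0<δ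
... | η , 0<η , refl with w+x≤y+z η 0<η
... | N , w+x≤y+z+η = η , 0<η , M ℕ.⊔ N , λ n ≤n → +-cancelʳ-≤ (seq z n + η) (begin
  seq w n + η + (seq z n + η)
    ≡⟨ solve 3 (λ w z η → w :+ η :+ (z :+ η) := w :+ (z :+ (η :+ η)))
         refl (seq w n) (seq z n) η ⟩
  seq w n + (seq z n + (η + η))
    ≤⟨ ℚ.+-monoʳ-≤ (seq w n) (z+δ≤x n (ℕ.m⊔n≤o⇒m≤o M N ≤n)) ⟩
  seq w n + seq x n
    ≤⟨ w+x≤y+z+η n (ℕ.m⊔n≤o⇒n≤o M N ≤n) ⟩
  seq y n + seq z n + η
    ≡⟨ ℚ.+-assoc (seq y n) (seq z n) η ⟩
  seq y n + (seq z n + η) ∎)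
  where open ℚ.≤-Reasoning

-- Serves the meet, which is the second summand in `Submodular`. Commuting the left-hand sum index
-- by index in ℚ reduces it to `+ℝ-exchangeʳ`.
+ℝ-exchangeˡ : ∀ {w x y z} → x +ℝ w ≤ℝ y +ℝ z → z <ℝ x → w <ℝ y
+ℝ-exchangeˡ {w} {x} {y} {z} x+w≤y+z = +ℝ-exchangeʳ {w} {x} {y} {z} λ ε 0<ε →
  let N , x+w≤y+z+ε = x+w≤y+z ε 0<ε in
  N , λ n N≤n →
    subst (_≤ seq y n + seq z n + ε) (ℚ.+-comm (seq x n) (seq w n)) (x+w≤y+z+ε n N≤n)

-- With `x` and `y` equal, a closed walk collapses to a single `R x x`, which is impossible for
-- irreflexive `R`.
Linked-ends : ∀ {a r} {A : Set a} {R : Rel A r} → Transitive R →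
              ∀ {x y} (zs : List A) → Linked R (x ∷ (zs ∷ʳ y)) → R x y
Linked-ends R-trans []       (Rxy ∷ [-]) = Rxy
Linked-ends R-trans (z ∷ zs) (Rxz ∷ Rzs) = R-trans Rxz (Linked-ends R-trans zs Rzs)

module _ {c ℓ₁ ℓ₂ p} (L : Lattice c ℓ₁ ℓ₂) {P : Pred (Lattice.Carrier L) p}
         (P-ois : OrderInducedSubmodular L P) where
  open Lattice L using (_∨_; _∧_)
  open OrderInducedSubmodular P-ois

  -- The threshold separates the values: `f a` lies strictly below `k`, while `f b` below `k` would
  -- put `b` in `P`.
  below-above : ∀ {a b} → P a → ¬ P b → f a <ℝ f b
  below-above {a} {b} a∈P b∉P =
    <ℝ-≤ℝ-trans {f a} {k} {f b} (proj₁ sublevel a∈P)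
      (≮ℝ⇒≥ℝ {f b} {k} λ fb<k → b∉P (proj₂ sublevel fb<k))

  join-descends : ∀ {a c} → P c → ¬ P (a ∧ c) → f (a ∨ c) <ℝ f a
  join-descends {a} {c} c∈P a∧c∉P =
    +ℝ-exchangeʳ {f (a ∨ c)} {f (a ∧ c)} {f a} {f c} (submodular a c) (below-above c∈P a∧c∉P)

  meet-descends : ∀ {a c} → P c → ¬ P (a ∨ c) → f (a ∧ c) <ℝ f a
  meet-descends {a} {c} c∈P a∨c∉P =
    +ℝ-exchangeˡ {f (a ∧ c)} {f (a ∨ c)} {f a} {f c} (submodular a c) (below-above c∈P a∨c∉P)

  edge-descends : ∀ {a b} → DependencyDigraph L P a b → f b <ℝ f a
  edge-descends {a} {b} = λ where
      (inj₁ (a∉P , b∈P))          → below-above b∈P a∉P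
      (inj₂ (inj₁ (_ , _ , via))) → via-descends via
      (inj₂ (inj₂ (_ , _ , via))) → via-descends via
    where
    -- The inferred argument type is `Via`, local to `DependencyDigraph` and shared by the edges
    -- inside `P` and those outside it.
    via-descends : _ → f b <ℝ f a
    via-descends (c , c∈P , inj₁ (b≈a∨c , a∧c∉P)) =
      ≤ℝ-<ℝ-trans {f b} {f (a ∨ c)} {f a} (proj₁ (f-cong b≈a∨c)) (join-descends c∈P a∧c∉P)
    via-descends (c , c∈P , inj₂ (b≈a∧c , a∨c∉P)) =
      ≤ℝ-<ℝ-trans {f b} {f (a ∧ c)} {f a} (proj₁ (f-cong b≈a∧c)) (meet-descends c∈P a∨c∉P)

corollary4p2 : ∀ {c ℓ₁ ℓ₂ p} (L : Lattice c ℓ₁ ℓ₂) → Finite (Lattice.setoid L) →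
    (P : Pred (Lattice.Carrier L) p) → P Respects (Lattice._≈_ L) →
    DirectedCycle (Lattice.setoid L) (DependencyDigraph L P) →
    ¬ OrderInducedSubmodular L P
corollary4p2 L _ P _ cycle P-ois =
  <ℝ-irrefl {f start} refl
    -- Transitivity is used for the reversed order, since an edge from `a` to `b` yields
    -- `f b <ℝ f a`.
    (Linked-ends (λ {a} {b} {c} fb<fa fc<fb → <ℝ-trans {f c} {f b} {f a} fc<fb fb<fa)
      rest (Linked.map (edge-descends L P-ois) edges))
  where
  open DirectedCycle cycle
  open OrderInducedSubmodular P-ois
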